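{- Let $\mathcal{I}=\langle\mathbf{C},\mathbb{X},O,tr\rangle$ be a context interactive system with $\|\mathbf{C}\|$ countable and $tr$ of countable degree, and let $\langle\mathbb{X},\alpha_{\mathcal{I}}\rangle$ be the $\mathbf{H}$-coalgebra of its saturated transition system. Then $\mathbf{Coalg}_{\mathbf{H}}$ has a final object, and the kernel of the unique morphism $!$ from $\langle\mathbb{X},\alpha_{\mathcal{I}}\rangle$ to the final $\mathbf{H}$-coalgebra coincides with saturated bisimilarity: for all $i\in|\mathbf{C}|$ and $p,q\in X_i$, $p\sim^S_i q$ if and only if $!(p)=!(q)$.
   Context: Composition is in diagrammatic order: $d;e$ means first $d$, then $e$. $|\mathbf{C}|$ and $\|\mathbf{C}\|$ are the sets of objects and arrows of a small category $\mathbf{C}$. A $\Gamma(\mathbf{C})$-algebra $\mathbb{X}$ is a family of sets $X=(X_i)_{i\in|\mathbf{C}|}$ with a function $c_{\mathbb{X}}:X_i\to X_j$ for every $c\in\mathbf{C}[i,j]$ such that $(id_i)_{\mathbb{X}}=id_{X_i}$ and $(d;e)_{\mathbb{X}}(x)=e_{\mathbb{X}}(d_{\mathbb{X}}(x))$ (i.e. a functor $\mathbf{C}\to\mathbf{Set}$); homomorphisms are natural transformations; the category is $\mathbf{Alg}_{\Gamma(\mathbf{C})}$. $\int X=\sum_iX_i$ is the disjoint union. A context interactive system is a quadruple $\langle\mathbf{C},\mathbb{X},O,tr\rangle$ with $\mathbf{C}$ a small category, $\mathbb{X}$ a $\Gamma(\mathbf{C})$-algebra, $O$ a set (observations) and $tr\subseteq\int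 X\times O\times\int X$; write $p\xrightarrow{o}p'$ for $(p,o,p')\in tr$. Countable degree means that each state has at most countably many outgoing transitions. Saturated bisimilarity. A family of symmetric relations $R=(R_i\subseteq X_i\times X_i)_{i\in|\mathbf{C}|}$ is a saturated bisimulation iff, for all $i,j$ and $c\in\mathbf{C}[i,j]$, whenever $p\,R_i\,q$: (1) $c_{\mathbb{X}}(p)\,R_j\,c_{\mathbb{X}}(q)$; (2) if $p\xrightarrow{o}p'$ with $p'\in X_k$, then there is $q'\in X_k$ with $q\xrightarrow{o}q'$ and $p'\,R_k\,q'$. $p\sim^S_iq$ iff $p\,R_i\,q$ for some saturated bisimulation $R$. $\mathbf{G}(X)_i$ is the set of (at most) countable subsets of $\sum_{j\in|\mathbf{C}|}\mathbf{C}[i,j]\times O\times\int X$. The endofunctor $\mathbf{H}$ of $\mathbf{Alg}_{\Gamma(\mathbf{C})}$ maps $\mathbb{X}$ to the algebra with carrier $(\mathbf{G}(X)_i)_i$ and operations, for $d\in\mathbf{C}[i,k]$, $d_{\mathbf{H}(\mathbb{X})}(A)=\{(c_2,o,x)\mid (c_1,o,x)\in A,\ c_1=d;c_2\}$; on arrows $\mathbf{H}(h)(A)=\{(c,o,h(x))\mid(c,o,x)\in A\}$. An $\mathbf{H}$-coalgebra is a pair $\langle\mathbb{X},\alpha:\mathbb{X}\to\mathbf{H}(\mathbb{X})\rangle$; morphisms $\langle\mathbb{X},\alpha\rangle\to\langle\mathbb{Y},\beta\rangle$ are homomorphisms $f$ with $\alpha;\mathbf{H}(f)=f;\beta$. For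 $p\in X_i$, $\alpha_{\mathcal{I}}(p)=\{(c,o,q)\mid c\in\mathbf{C}[i,j]\text{ for some }j,\ (c_{\mathbb{X}}(p),o,q)\in tr\}$. -}

module Defs where

open import Level using (Level; _⊔_) renaming (suc to lsuc)
open import Axiom.UniquenessOfIdentityProofs.WithK using (uip)
open import Data.Nat.Base using (ℕ; zero; suc; _*_)
open import Data.Nat.Properties using (*-cancelˡ-≡; suc-injective; even≢odd)
open import Data.Product.Base using (Σ; ∃; ∃₂; _×_; _,_; proj₁; proj₂)
open import Data.Product.Relation.Binary.Pointwise.NonDependent using (_×ₛ_)
open import Function.Base using (_∘_)
open import Function.Bundles using (Func; _⟨$⟩_; _⇔_; mk⇔; Equivalence)
open import Relation.Binary.Bundles using (Setoid)
open import Relation.Binary.Core using (Rel)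
open import Relation.Binary.Definitions using (Symmetric)
open import Relation.Binary.PropositionalEquality
  using (_≡_; refl; sym; trans; cong; subst; setoid)
open import Relation.Nullary using (contradiction; Irrelevant)
open import Relation.Unary using (Pred; U)

open Setoid using (Carrier)

-- Conventions.  There are no quotient types, so "set" is read as "setoid" and
-- "function" as "equality-preserving function", except for the objects and
-- arrows of a small category, which are types with propositional equality.
-- Setoids have carrier in Set (suc ℓ) and equality in Set ℓ: this class is
-- closed under the formation of countable subsets, see CountableSubset.

------------------------------------------------------------------------
-- Disjoint unions of setoids

module _ {i a r} {I : Set i} (A : I → Setoid a r) where

  -- Transport rather than an inductive family: the level of the equality must
  -- not depend on the level of the carriers.
  ∐-≈ : Rel (Σ I (Carrier ∘ A)) (i ⊔ r)
  ∐-≈ (j , x) (k , y) =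
    Σ (j ≡ k) λ e → Setoid._≈_ (A k) (subst (Carrier ∘ A) e x) y

  ∐ : Setoid (i ⊔ a) (i ⊔ r)
  ∐ = record
    { Carrier       = Σ I (Carrier ∘ A)
    ; _≈_           = ∐-≈
    ; isEquivalence = record
      { refl  = λ {x} → refl , Setoid.refl (A (proj₁ x))
      ; sym   = λ { {j , _} (refl , p) → refl , Setoid.sym (A j) p }
      ; trans = λ { {j , _} (refl , p) (refl , q) →
                    refl , Setoid.trans (A j) p q }
      }
    }

------------------------------------------------------------------------
-- At most countable subsets

-- An at most countable subset of A is the image of a function into A defined
-- on a subset of ℕ.  The subset of ℕ is an arbitrary proposition-valued
-- predicate (dom-irr), not necessarily decidable; with excluded middle this is
-- the usual notion of countability.  Different enumerations of the same subset
-- are identified in 𝒫ω below.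
record CountableSubset {a r} (A : Setoid a r) : Set (a ⊔ lsuc r) where
  field
    dom     : Pred ℕ r
    dom-irr : ∀ {n} → Irrelevant (dom n)
    enum    : ∀ {n} → dom n → Carrier A

open CountableSubset

module _ {a r} {A : Setoid a r} where

  private module A = Setoid A

  infix 4 _∈_ _⊆_

  _∈_ : A.Carrier → CountableSubset A → Set r
  x ∈ S = ∃₂ λ n (d : dom S n) → enum S d A.≈ x

  -- Inclusion, with the quantifier ranging over the enumerated elements of S
  -- so that it stays in Set r.  See ⊆-elim and ⊆-intro.
  _⊆_ : CountableSubset A → CountableSubset A → Set r
  S ⊆ T = ∀ {n} (d : dom S n) → enum S d ∈ T

  ∈-resp : ∀ (S : CountableSubset A) {x y} → x A.≈ y → x ∈ S → y ∈ S
  ∈-resp S e (n , d , p) = n , d , A.trans p e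

  enum-∈ : ∀ (S : CountableSubset A) {n} (d : dom S n) → enum S d ∈ S
  enum-∈ S d = _ , d , A.refl

  ⊆-elim : ∀ (S T : CountableSubset A) → S ⊆ T → ∀ {x} → x ∈ S → x ∈ T
  ⊆-elim S T h (n , d , p) = ∈-resp T p (h d)

  ⊆-intro : ∀ (S T : CountableSubset A) → (∀ {x} → x ∈ S → x ∈ T) → S ⊆ T
  ⊆-intro S T h d = h (enum-∈ S d)

  IsCountable : ∀ {p} → Pred A.Carrier p → Set (a ⊔ lsuc r ⊔ p)
  IsCountable P = Σ (CountableSubset A) λ S → ∀ x → P x ⇔ x ∈ S

-- The set of at most countable subsets of A, with extensional equality.
𝒫ω : ∀ {a r} → Setoid a r → Setoid (a ⊔ lsuc r) r
𝒫ω A = record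
  { Carrier       = CountableSubset A
  ; _≈_           = λ S T → S ⊆ T × T ⊆ S
  ; isEquivalence = record
    { refl  = λ {S} → enum-∈ S , enum-∈ S
    ; sym   = λ (p , q) → q , p
    ; trans = λ {S} {T} {U} (p , p′) (q , q′) →
        (λ d → ⊆-elim T U q (p d)) , (λ d → ⊆-elim T S p′ (q′ d))
    }
  }

IsCountable-≈ : ∀ {a r p q} {A : Setoid a r}
  {P : Pred (Carrier A) p} {Q : Pred (Carrier A) q}
  ((S , _) : IsCountable {A = A} P) ((T , _) : IsCountable {A = A} Q) →
  (∀ {x} → P x → Q x) → (∀ {x} → Q x → P x) → Setoid._≈_ (𝒫ω A) S T
IsCountable-≈ {A = A} (S , hS) (T , hT) f g =
  ⊆-intro S T (λ {x} m → to (hT x) (f (from (hS x) m))) ,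
  ⊆-intro T S (λ {x} m → to (hS x) (g (from (hT x) m)))
  where open Equivalence

image : ∀ {a b r} {A : Setoid a r} {B : Setoid b r} →
        (Carrier A → Carrier B) → CountableSubset A → CountableSubset B
image f S = record
  { dom = dom S ; dom-irr = dom-irr S ; enum = λ d → f (enum S d) }

-- pair n m = 2ⁿ(2m+1)
pair : ℕ → ℕ → ℕ
pair zero    m = suc (2 * m)
pair (suc n) m = 2 * pair n m

pair-injective : ∀ {n m n′ m′} → pair n m ≡ pair n′ m′ → (n , m) ≡ (n′ , m′)
pair-injective {zero} {m} {zero} {m′} e
  with refl ← *-cancelˡ-≡ m m′ 2 (suc-injective e) = refl
pair-injective {zero} {m} {suc n′} {m′} e =
  contradiction (sym e) (even≢odd (pair n′ m′) m)
pair-injective {suc n} {m} {zero} {m′} e =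
  contradiction e (even≢odd (pair n m) m′)
pair-injective {suc n} {m} {suc n′} {m′} e
  with refl ← pair-injective {n} {m} {n′} {m′}
                (*-cancelˡ-≡ (pair n m) (pair n′ m′) 2 e) = refl

-- Countable unions of countable subsets.
module _ {b r} {B : Setoid b r}
  {D : Pred ℕ r} (D-irr : ∀ {n} → Irrelevant (D n))
  {E : ∀ {n} → D n → Pred ℕ r}
  (E-irr : ∀ {n} (d : D n) {m} → Irrelevant (E d m))
  (f : ∀ {n} (d : D n) {m} → E d m → Carrier B)
  where

  private
    Index : Pred ℕ r
    Index z = ∃₂ λ n m → pair n m ≡ z × Σ (D n) λ d → E d m

    Index-irr : ∀ {z} → Irrelevant (Index z)
    Index-irr (n , m , p , d , e) (n′ , m′ , p′ , d′ , e′)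
      with refl ← pair-injective {n} {m} {n′} {m′} (trans p (sym p′))
      with refl ← uip p p′ with refl ← D-irr d d′
      with refl ← E-irr d e e′ = refl

  union : CountableSubset B
  union = record
    { dom     = Index
    ; dom-irr = Index-irr
    ; enum    = λ (_ , _ , _ , d , e) → f d e
    }

  ∈-union : ∀ {n} (d : D n) {m} (e : E d m) {x} →
            Setoid._≈_ B (f d e) x → _∈_ {A = B} x union
  ∈-union {n} d {m} e p = pair n m , (n , m , refl , d , e) , p

------------------------------------------------------------------------
-- Categories, final objects, coalgebras

record Category o h e : Set (lsuc (o ⊔ h ⊔ e)) where
  infixl 7 _⨾_
  field
    Obj    : Set o
    Hom    : Obj → Obj → Setoid h e

  _⇒_ : Obj → Obj → Set h
  A ⇒ B = Carrier (Hom A B)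

  _≈_ : ∀ {A B} → Rel (A ⇒ B) e
  _≈_ {A} {B} = Setoid._≈_ (Hom A B)

  field
    id      : ∀ {A} → A ⇒ A
    _⨾_     : ∀ {A B C} → A ⇒ B → B ⇒ C → A ⇒ C
    ⨾-cong  : ∀ {A B C} {f f′ : A ⇒ B} {g g′ : B ⇒ C} →
              f ≈ f′ → g ≈ g′ → (f ⨾ g) ≈ (f′ ⨾ g′)
    ⨾-idˡ   : ∀ {A B} (f : A ⇒ B) → (id ⨾ f) ≈ f
    ⨾-idʳ   : ∀ {A B} (f : A ⇒ B) → (f ⨾ id) ≈ f
    ⨾-assoc : ∀ {A B C D} (f : A ⇒ B) (g : B ⇒ C) (h : C ⇒ D) →
              ((f ⨾ g) ⨾ h) ≈ (f ⨾ (g ⨾ h))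

record FinalObject {o h e} (𝒞 : Category o h e) : Set (o ⊔ h ⊔ e) where
  open Category 𝒞
  field
    ⊤        : Obj
    !        : (A : Obj) → A ⇒ ⊤
    !-unique : ∀ {A} (f : A ⇒ ⊤) → f ≈ ! A

record Endofunctor {o h e} (𝒞 : Category o h e) : Set (o ⊔ h ⊔ e) where
  open Category 𝒞
  field
    F₀     : Obj → Obj
    F₁     : ∀ {A B} → A ⇒ B → F₀ A ⇒ F₀ B
    F-cong : ∀ {A B} {f g : A ⇒ B} → f ≈ g → F₁ f ≈ F₁ g
    F-id   : ∀ {A} → F₁ (id {A}) ≈ id
    F-⨾    : ∀ {A B C} (f : A ⇒ B) (g : B ⇒ C) → F₁ (f ⨾ g) ≈ (F₁ f ⨾ F₁ g)

module _ {o h e} {𝒞 : Category o h e} (F : Endofunctor 𝒞) where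
  open Category 𝒞
  open Endofunctor F

  record Coalgebra : Set (o ⊔ h) where
    constructor ⟨_,_⟩
    field
      carrier   : Obj
      structure : carrier ⇒ F₀ carrier

  record CoalgebraMorphism (A B : Coalgebra) : Set (h ⊔ e) where
    private
      module A = Coalgebra A
      module B = Coalgebra B
    field
      arrow    : A.carrier ⇒ B.carrier
      commutes : (A.structure ⨾ F₁ arrow) ≈ (arrow ⨾ B.structure)

  open Coalgebra
  open CoalgebraMorphism

  private
    module Hom {A B} = Setoid (Hom A B)

  Coalg : Category (o ⊔ h) (h ⊔ e) e
  Coalg = record
    { Obj     = Coalgebra
    ; Hom     = λ A B → record
      { Carrier       = CoalgebraMorphism A B
      ; _≈_           = λ f g → arrow f ≈ arrow g
      ; isEquivalence = record
        { refl = Hom.refl ; sym = Hom.sym ; trans = Hom.trans }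
      }
    ; id      = record
      { arrow    = id
      ; commutes = Hom.trans (⨾-cong Hom.refl F-id)
                     (Hom.trans (⨾-idʳ _) (Hom.sym (⨾-idˡ _)))
      }
    ; _⨾_     = λ f g → record
      { arrow    = arrow f ⨾ arrow g
      ; commutes =
          Hom.trans (⨾-cong Hom.refl (F-⨾ _ _))
          (Hom.trans (Hom.sym (⨾-assoc _ _ _))
          (Hom.trans (⨾-cong (commutes f) Hom.refl)
          (Hom.trans (⨾-assoc _ _ _)
          (Hom.trans (⨾-cong Hom.refl (commutes g))
          (Hom.sym (⨾-assoc _ _ _))))))
      }
    ; ⨾-cong  = ⨾-cong
    ; ⨾-idˡ   = λ f → ⨾-idˡ (arrow f)
    ; ⨾-idʳ   = λ f → ⨾-idʳ (arrow f)
    ; ⨾-assoc = λ f g h → ⨾-assoc (arrow f) (arrow g) (arrow h)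
    }

------------------------------------------------------------------------
-- Small categories and Γ(C)-algebras

record SmallCategory ℓ : Set (lsuc ℓ) where
  infixl 7 _⨾_
  infix  4 _[_,_]
  field
    ∣_∣     : Set ℓ
    _[_,_]  : ∣_∣ → ∣_∣ → Set ℓ
    id      : ∀ i → _[_,_] i i
    _⨾_     : ∀ {i j k} → _[_,_] i j → _[_,_] j k → _[_,_] i k
    ⨾-idˡ   : ∀ {i j} (c : _[_,_] i j) → id i ⨾ c ≡ c
    ⨾-idʳ   : ∀ {i j} (c : _[_,_] i j) → c ⨾ id j ≡ c
    ⨾-assoc : ∀ {i j k l} (c : _[_,_] i j) (d : _[_,_] j k) (e : _[_,_] k l) →
              (c ⨾ d) ⨾ e ≡ c ⨾ (d ⨾ e)

  ArrowFrom : ∣_∣ → Set ℓ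
  ArrowFrom i = Σ ∣_∣ λ j → _[_,_] i j

  ‖_‖ : Set ℓ
  ‖_‖ = Σ ∣_∣ ArrowFrom

open SmallCategory using (∣_∣; _[_,_]; ‖_‖; ArrowFrom)

module _ {ℓ} {C : SmallCategory ℓ} {i : ∣ C ∣} where

  from : (c : ‖ C ‖) → proj₁ c ≡ i → ArrowFrom C i
  from (_ , c) refl = c

  from-≡ : ∀ {c c′} (r : c ≡ (i , c′)) → from c (cong proj₁ r) ≡ c′
  from-≡ refl = refl

CountablyManyArrows : ∀ {ℓ} → SmallCategory ℓ → Set (lsuc ℓ)
CountablyManyArrows C = IsCountable {A = setoid ‖ C ‖} U

module _ {ℓ} (C : SmallCategory ℓ) where

  private module C = SmallCategory C

  record Algebra : Set (lsuc (lsuc ℓ)) where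
    field
      X     : ∣ C ∣ → Setoid (lsuc ℓ) ℓ
      op    : ∀ {i j} → C [ i , j ] → Func (X i) (X j)
      op-id : ∀ {i} x → Setoid._≈_ (X i) (op (C.id i) ⟨$⟩ x) x
      op-⨾  : ∀ {i j k} (d : C [ i , j ]) (e : C [ j , k ]) x →
              Setoid._≈_ (X k) (op (d C.⨾ e) ⟨$⟩ x) (op e ⟨$⟩ (op d ⟨$⟩ x))

    ∫ : Setoid (lsuc ℓ) ℓ
    ∫ = ∐ X

  record Homomorphism (𝕏 𝕐 : Algebra) : Set (lsuc ℓ) where
    private
      module 𝕏 = Algebra 𝕏
      module 𝕐 = Algebra 𝕐
    field
      map     : ∀ i → Func (𝕏.X i) (𝕐.X i)
      natural : ∀ {i j} (c : C [ i , j ]) x → Setoid._≈_ (𝕐.X j)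
                (map j ⟨$⟩ (𝕏.op c ⟨$⟩ x)) (𝕐.op c ⟨$⟩ (map i ⟨$⟩ x))

    ∫map : Carrier 𝕏.∫ → Carrier 𝕐.∫
    ∫map (i , x) = i , map i ⟨$⟩ x

    ∫map-cong : ∀ {x y} → Setoid._≈_ 𝕏.∫ x y →
                Setoid._≈_ 𝕐.∫ (∫map x) (∫map y)
    ∫map-cong {j , _} (refl , p) = refl , Func.cong (map j) p

  Alg : Category (lsuc (lsuc ℓ)) (lsuc ℓ) (lsuc ℓ)
  Alg = record
    { Obj     = Algebra
    ; Hom     = λ 𝕏 𝕐 → let module ≈ {i} = Setoid (Algebra.X 𝕐 i) in record
      { Carrier       = Homomorphism 𝕏 𝕐
      ; _≈_           = λ f g → ∀ i x → (map f i ⟨$⟩ x) ≈.≈ (map g i ⟨$⟩ x)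
      ; isEquivalence = record
        { refl  = λ _ _ → ≈.refl
        ; sym   = λ p i x → ≈.sym (p i x)
        ; trans = λ p q i x → ≈.trans (p i x) (q i x)
        }
      }
    ; id      = λ {𝕏} → record
      { map     = λ i → record { to = λ x → x ; cong = λ p → p }
      ; natural = λ {_} {j} _ _ → Setoid.refl (Algebra.X 𝕏 j)
      }
    ; _⨾_     = λ {_} {_} {ℤ} f g → record
      { map     = λ i → record
        { to   = λ x → map g i ⟨$⟩ (map f i ⟨$⟩ x)
        ; cong = λ p → Func.cong (map g i) (Func.cong (map f i) p)
        }
      ; natural = λ {_} {j} c x → Setoid.trans (Algebra.X ℤ j)
          (Func.cong (map g j) (natural f c x)) (natural g c _)
      }
    ; ⨾-cong  = λ {_} {_} {ℤ} {_} {_} {g} p q i x → Setoid.trans (Algebra.X ℤ i)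
        (Func.cong (map g i) (p i x)) (q i _)
    ; ⨾-idˡ   = λ {_} {𝕐} _ i _ → Setoid.refl (Algebra.X 𝕐 i)
    ; ⨾-idʳ   = λ {_} {𝕐} _ i _ → Setoid.refl (Algebra.X 𝕐 i)
    ; ⨾-assoc = λ {_} {_} {_} {𝕎} _ _ _ i _ → Setoid.refl (Algebra.X 𝕎 i)
    }
    where open Homomorphism

------------------------------------------------------------------------
-- The endofunctor H

module _ {ℓ} (C : SmallCategory ℓ) (C-countable : CountablyManyArrows C)
         (O : Setoid (lsuc ℓ) ℓ) where

  private
    module C = SmallCategory C
    module O = Setoid O

  Triples : Algebra C → ∣ C ∣ → Setoid (lsuc ℓ) ℓ
  Triples 𝕏 i = setoid (ArrowFrom C i) ×ₛ (O ×ₛ Algebra.∫ 𝕏)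

  G : Algebra C → ∣ C ∣ → Setoid (lsuc ℓ) ℓ
  G 𝕏 i = 𝒫ω (Triples 𝕏 i)

  private
    arrows : CountableSubset (setoid ‖ C ‖)
    arrows = proj₁ C-countable

    arrow-∈ : ∀ c → c ∈ arrows
    arrow-∈ c = Equivalence.to (proj₂ C-countable c) _

    precompose : ∀ {i k} → C [ i , k ] → ArrowFrom C k → ArrowFrom C i
    precompose d (j , c) = j , d C.⨾ c

  module _ (𝕏 : Algebra C) where
    open Algebra 𝕏

    -- {(c₂,o,x) | (c₁,o,x) ∈ A, c₁ = d ⨾ c₂}
    d⟦_⟧ : ∀ {i k} → C [ i , k ] → CountableSubset (Triples 𝕏 i) →
           Pred (Carrier (Triples 𝕏 k)) ℓ
    d⟦_⟧ {i} d A ((j , c₂) , o , x) = Σ (C [ i , j ]) λ c₁ →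
      _∈_ {A = Triples 𝕏 i} ((j , c₁) , o , x) A × c₁ ≡ d C.⨾ c₂

    d⟦⟧-countable : ∀ {i k} (d : C [ i , k ]) A →
                    IsCountable {A = Triples 𝕏 k} (d⟦ d ⟧ A)
    d⟦⟧-countable {i} {k} d A = S , λ t → mk⇔ (⇒ t) (⇐ t)
      where
      E : ∀ {n} → dom A n → Pred ℕ ℓ
      E a m = Σ (dom arrows m) λ b → Σ (proj₁ (enum arrows b) ≡ k) λ s →
        precompose d (from {C = C} (enum arrows b) s) ≡ proj₁ (enum A a)

      E-irr : ∀ {n} (a : dom A n) {m} → Irrelevant (E a m)
      E-irr a (b , s , p) (b′ , s′ , p′)
        with refl ← dom-irr arrows b b′
        with refl ← uip s s′ with refl ← uip p p′ = refl

      f : ∀ {n} (a : dom A n) {m} → E a m → Carrier (Triples 𝕏 k)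
      f a (b , s , _) = from {C = C} (enum arrows b) s , proj₂ (enum A a)

      S : CountableSubset (Triples 𝕏 k)
      S = union {B = Triples 𝕏 k} (dom-irr A) {E} E-irr f

      ⇒ : ∀ t → d⟦ d ⟧ A t → _∈_ {A = Triples 𝕏 k} t S
      ⇒ ((j , c₂) , t) (c₁ , (n , a , p , q) , refl)
        with arrow-∈ (k , j , c₂)
      ... | m , b , r =
        ∈-union {B = Triples 𝕏 k} (dom-irr A) {E} E-irr f a
          (b , cong proj₁ r , trans (cong (precompose d) (from-≡ {C = C} r)) (sym p))
          (from-≡ {C = C} r , q)

      ⇐ : ∀ t → _∈_ {A = Triples 𝕏 k} t S → d⟦ d ⟧ A t
      ⇐ t (_ , (n , m , _ , a , b , s , p) , refl , q) =
        _ , (n , a , sym p , q) , refl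

    private
      module G {i} = Setoid (G 𝕏 i)

      act : ∀ {i k} → C [ i , k ] →
            CountableSubset (Triples 𝕏 i) → CountableSubset (Triples 𝕏 k)
      act d A = proj₁ (d⟦⟧-countable d A)

      act-⇔ : ∀ {i k} (d : C [ i , k ]) A t →
              d⟦ d ⟧ A t ⇔ _∈_ {A = Triples 𝕏 k} t (act d A)
      act-⇔ d A = proj₂ (d⟦⟧-countable d A)

      act-cong : ∀ {i k} (d : C [ i , k ]) {A B} → A G.≈ B → act d A G.≈ act d B
      act-cong {i} {k} d {A} {B} (p , q) =
        IsCountable-≈ {A = Triples 𝕏 k} (d⟦⟧-countable d A) (d⟦⟧-countable d B)
          (λ (c₁ , m , e) → c₁ , ⊆-elim {A = Triples 𝕏 i} A B p m , e)
          (λ (c₁ , m , e) → c₁ , ⊆-elim {A = Triples 𝕏 i} B A q m , e)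

      act-id : ∀ {i} A → act (C.id i) A G.≈ A
      act-id {i} A =
        IsCountable-≈ {A = Triples 𝕏 i} (d⟦⟧-countable (C.id i) A)
          (A , λ _ → mk⇔ (λ m → m) (λ m → m))
          (λ { {(j , c) , _} (c₁ , m , e) → subst (λ c → ((j , c) , _) ∈ᵢ A)
                 (trans e (C.⨾-idˡ c)) m })
          (λ { {(j , c) , _} m → c , m , sym (C.⨾-idˡ c) })
        where _∈ᵢ_ = _∈_ {A = Triples 𝕏 i}

      act-⨾ : ∀ {i j k} (d : C [ i , j ]) (e : C [ j , k ]) A →
              act (d C.⨾ e) A G.≈ act e (act d A)
      act-⨾ {i} {j} {k} d e A =
        IsCountable-≈ {A = Triples 𝕏 k}
          (d⟦⟧-countable (d C.⨾ e) A) (d⟦⟧-countable e (act d A))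
          (λ { {(_ , c) , _} (c₁ , m , p) →
               e C.⨾ c
             , Equivalence.to (act-⇔ d A _)
                 (c₁ , m , trans p (C.⨾-assoc d e c))
             , refl })
          (λ { {(_ , c) , _} (_ , m , refl) →
               let c₁ , m′ , p = Equivalence.from (act-⇔ d A _) m in
               c₁ , m′ , trans p (sym (C.⨾-assoc d e c)) })

    H₀ : Algebra C
    H₀ = record
      { X     = G 𝕏
      ; op    = λ d → record { to = act d ; cong = λ {A} {B} → act-cong d {A} {B} }
      ; op-id = act-id
      ; op-⨾  = act-⨾
      }

  module _ {𝕏 𝕐 : Algebra C} (h : Homomorphism C 𝕏 𝕐) where
    open Homomorphism h

    private
      module 𝕐 = Algebra 𝕐

      triple : ∀ {i} → Carrier (Triples 𝕏 i) → Carrier (Triples 𝕐 i)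
      triple (c , o , x) = c , o , ∫map x

      -- {(c,o,h(x)) | (c,o,x) ∈ A}
      img : ∀ {i} → CountableSubset (Triples 𝕏 i) → CountableSubset (Triples 𝕐 i)
      img {i} = image {A = Triples 𝕏 i} {B = Triples 𝕐 i} triple

      img-mono : ∀ {i} A B → _⊆_ {A = Triples 𝕏 i} A B →
                 _⊆_ {A = Triples 𝕐 i} (img A) (img B)
      img-mono A B p a =
        let n , b , r , s , t = p a in n , b , r , s , ∫map-cong t

      img-natural : ∀ {i k} (d : C [ i , k ]) A → Setoid._≈_ (G 𝕐 k)
        (img (Algebra.op (H₀ 𝕏) d ⟨$⟩ A)) (Algebra.op (H₀ 𝕐) d ⟨$⟩ (img A))
      img-natural {i} {k} d A =
          (λ { (n , m , _ , a , b , s , p) →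
               Equivalence.to (proj₂ (d⟦⟧-countable 𝕐 d (img A)) _)
                 (_ , (n , a , sym p , O.refl , Setoid.refl 𝕐.∫) , refl) })
        , (λ { (n , m , _ , a , b , s , p) →
               let l , u , v , w , x = Equivalence.to
                     (proj₂ (d⟦⟧-countable 𝕏 d A) _)
                     (_ , (n , a , sym p , O.refl , Setoid.refl (Algebra.∫ 𝕏)) , refl)
               in l , u , v , w , ∫map-cong x })

    H₁ : Homomorphism C (H₀ 𝕏) (H₀ 𝕐)
    H₁ = record
      { map     = λ i → record
        { to   = img
        ; cong = λ {A} {B} (p , q) → img-mono A B p , img-mono B A q
        }
      ; natural = img-natural
      }

  H : Endofunctor (Alg C)
  H = record
    { F₀     = H₀
    ; F₁     = H₁
    ; F-cong = λ {_} {𝕐} p i A →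
        (λ {n} a → n , a , refl , O.refl , refl ,
                   Setoid.sym (Algebra.X 𝕐 _) (p _ _))
      , (λ {n} a → n , a , refl , O.refl , refl , p _ _)
    ; F-id   = λ {𝕏} i A → Setoid.refl (G 𝕏 i) {A}
    ; F-⨾    = λ {_} {_} {ℤ} f g i A →
        Setoid.refl (G ℤ i) {Homomorphism.map (H₁ g) i ⟨$⟩ (Homomorphism.map (H₁ f) i ⟨$⟩ A)}
    }

------------------------------------------------------------------------
-- Context interactive systems

record ContextInteractiveSystem ℓ : Set (lsuc (lsuc ℓ)) where
  field
    C : SmallCategory ℓ
    𝕏 : Algebra C
    O : Setoid (lsuc ℓ) ℓ

  open Algebra 𝕏 public

  field
    tr      : Carrier ∫ → Carrier O → Carrier ∫ → Set ℓ
    tr-resp : ∀ {p p′ o o′ q q′} →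
              Setoid._≈_ ∫ p p′ → Setoid._≈_ O o o′ → Setoid._≈_ ∫ q q′ →
              tr p o q → tr p′ o′ q′

module _ {ℓ} (ℐ : ContextInteractiveSystem ℓ) where
  open ContextInteractiveSystem ℐ

  CountableDegree : Set (lsuc ℓ)
  CountableDegree = ∀ p → IsCountable {A = O ×ₛ ∫} (λ (o , q) → tr p o q)

  record IsSaturatedBisimulation (R : ∀ i → Rel (Carrier (X i)) ℓ)
         : Set (lsuc ℓ) where
    field
      -- R i is a relation on the setoid X i
      respects  : ∀ {i p p′ q q′} → Setoid._≈_ (X i) p p′ →
                  Setoid._≈_ (X i) q q′ → R i p q → R i p′ q′
      symmetric : ∀ i → Symmetric (R i)
      closed    : ∀ {i j} (c : C [ i , j ]) {p q} → R i p q →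
                  R j (op c ⟨$⟩ p) (op c ⟨$⟩ q)
      simulates : ∀ {i p q} → R i p q →
                  ∀ {o k} {p′ : Carrier (X k)} → tr (i , p) o (k , p′) →
                  Σ (Carrier (X k)) λ q′ → tr (i , q) o (k , q′) × R k p′ q′

  infix 4 _∼ˢ_

  _∼ˢ_ : ∀ {i} → Rel (Carrier (X i)) (lsuc ℓ)
  _∼ˢ_ {i} p q = Σ (∀ i → Rel (Carrier (X i)) ℓ) λ R →
    IsSaturatedBisimulation R × R i p q

  module _ (C-countable : CountablyManyArrows C)
           (tr-countable : CountableDegree) where

    private
      module C = SmallCategory C

      T : ∣ C ∣ → Setoid (lsuc ℓ) ℓ
      T = Triples C C-countable O 𝕏

    saturatedTransitions : ∀ {i} → Carrier (X i) → Pred (Carrier (T i)) ℓ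
    saturatedTransitions p ((j , c) , o , q) = tr (j , op c ⟨$⟩ p) o q

    saturatedTransitions-countable : ∀ {i} (p : Carrier (X i)) →
      IsCountable {A = T i} (saturatedTransitions p)
    saturatedTransitions-countable {i} p = S , λ t → mk⇔ (⇒ t) (⇐ t)
      where
      arrows : CountableSubset (setoid ‖ C ‖)
      arrows = proj₁ C-countable

      D : Pred ℕ ℓ
      D n = Σ (dom arrows n) λ a → proj₁ (enum arrows a) ≡ i

      D-irr : ∀ {n} → Irrelevant (D n)
      D-irr (a , s) (a′ , s′)
        with refl ← dom-irr arrows a a′ with refl ← uip s s′ = refl

      arrow : ∀ {n} → D n → ArrowFrom C i
      arrow (a , s) = from {C = C} (enum arrows a) s

      apply : ArrowFrom C i → Carrier ∫
      apply (j , c) = j , op c ⟨$⟩ p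

      next : ∀ c → CountableSubset (O ×ₛ ∫)
      next c = proj₁ (tr-countable (apply c))

      E : ∀ {n} → D n → Pred ℕ ℓ
      E d = dom (next (arrow d))

      E-irr : ∀ {n} (d : D n) {m} → Irrelevant (E d m)
      E-irr d = dom-irr (next (arrow d))

      f : ∀ {n} (d : D n) {m} → E d m → Carrier (T i)
      f d e = arrow d , enum (next (arrow d)) e

      S : CountableSubset (T i)
      S = union {B = T i} {D} D-irr {E} E-irr f

      ⇒ : ∀ t → saturatedTransitions p t → _∈_ {A = T i} t S
      ⇒ (c , t) h
        with Equivalence.to (proj₂ C-countable (i , c)) _
      ... | n , a , r =
          let d : D n
              d          = a , cong proj₁ r
              d≡c        = from-≡ {C = C} r
              m , e , r′ = Equivalence.to (proj₂ (tr-countable (apply (arrow d))) t)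
                             (subst (λ c → tr (apply c) (proj₁ t) (proj₂ t))
                               (sym d≡c) h)
          in ∈-union {B = T i} {D} D-irr {E} E-irr f d e (d≡c , r′)

      ⇐ : ∀ t → _∈_ {A = T i} t S → saturatedTransitions p t
      ⇐ (c , t) (_ , (n , m , _ , d , e) , refl , q) =
        Equivalence.from (proj₂ (tr-countable (apply c)) t) (m , e , q)

    α : Homomorphism C 𝕏 (H₀ C C-countable O 𝕏)
    α = record
      { map     = λ i → record
        { to   = λ p → proj₁ (saturatedTransitions-countable p)
        ; cong = λ {p} {q} e →
            IsCountable-≈ {A = T i}
              (saturatedTransitions-countable p) (saturatedTransitions-countable q)
              (λ { {(_ , c) , _} →
                   tr-resp (refl , Func.cong (op c) e) O.refl ∫.refl })
              (λ { {(_ , c) , _} →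
                   tr-resp (refl , Func.cong (op c) (Setoid.sym (X i) e))
                     O.refl ∫.refl })
        }
      ; natural = λ {i} {k} d p →
          IsCountable-≈ {A = T k}
            (saturatedTransitions-countable (op d ⟨$⟩ p))
            (d⟦⟧-countable C C-countable O 𝕏 d
              (proj₁ (saturatedTransitions-countable p)))
            (λ { {(j , c) , _} h →
                 d C.⨾ c
               , Equivalence.to (proj₂ (saturatedTransitions-countable p) _)
                   (tr-resp (refl , Setoid.sym (X j) (op-⨾ d c p))
                     O.refl ∫.refl h)
               , refl })
            (λ { {(j , c) , _} (_ , m , refl) →
                 tr-resp (refl , op-⨾ d c p) O.refl ∫.refl
                   (Equivalence.from
                     (proj₂ (saturatedTransitions-countable p) _) m) })
      }
      where
      module O = Setoid O
      module ∫ = Setoid ∫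

    saturatedCoalgebra : Coalgebra (H C C-countable O)
    saturatedCoalgebra = ⟨ 𝕏 , α ⟩

{-# OPTIONS --safe #-}

-- The carrier of H(𝕏) does not depend on the operations of 𝕏, so a final
-- H-coalgebra is obtained by equipping a final coalgebra of G on families of
-- sets with the operations that its structure map dictates.  Its elements of
-- sort k are pointed countably branching graphs with a context into k still to
-- be applied, taken up to bisimilarity.  The behaviour of a state is its graph
-- of paths.  The relation between a state and the behaviours that it unfolds
-- to, the graph of a coalgebra morphism, and a saturated bisimulation are all
-- bisimulations of transition systems, so every required equality of behaviours
-- follows by composing them.
--
-- Quantifying over all bisimulations would raise the universe level, but the
-- equality of behaviours has to lie in Set ℓ.  It is therefore defined as the
-- existence of a winning strategy in the bisimulation game, a strategy being a
-- coherent sequence of its finite approximations.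
module Submission where

open import Defs
open import Level using (Level; _⊔_) renaming (suc to lsuc)
open import Data.Nat.Base using (ℕ; zero; suc)
open import Data.Product.Base using (Σ; ∃; _×_; _,_; proj₁; proj₂)
open import Data.Sum.Base using (_⊎_; inj₁; inj₂)
open import Data.Unit.Polymorphic.Base using (tt) renaming (⊤ to Unit)
open import Function.Base using (flip)
open import Function.Bundles using (Func; _⟨$⟩_; _⇔_; mk⇔; Equivalence)
open import Relation.Binary.Bundles using (Setoid)
open import Relation.Binary.Core using (REL; Rel)
open import Relation.Binary.PropositionalEquality
  using (_≡_; refl; sym; trans; cong; subst)
open import Relation.Nullary using (Irrelevant)
open import Relation.Unary using (Pred)

open Setoid using (Carrier)
open SmallCategory using (∣_∣; _[_,_]; ArrowFrom)
open CountableSubset using (dom; dom-irr; enum)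

-- Infinite games and winning strategies.

module Game {ℓ} {I : Set ℓ} (A : I → Set ℓ) (B : ∀ {i} → A i → Set ℓ)
            (next : ∀ {i} {a : A i} → B a → I) where

  module _ (i₀ : I) where

    Strategy : ℕ → Set ℓ
    Play     : ∀ n → Strategy n → Set ℓ
    end      : ∀ n (σ : Strategy n) → Play n σ → I

    Strategy zero    = Unit
    Strategy (suc n) =
      Σ (Strategy n) λ σ → (π : Play n σ) (a : A (end n σ π)) → B a

    Play zero    _       = Unit
    Play (suc n) (σ , _) = Σ (Play n σ) λ π → A (end n σ π)

    end zero    _       _       = i₀
    end (suc n) (_ , r) (π , a) = next (r π a)

    Reaches : ∀ n → Strategy n → I → Set ℓ
    Reaches n σ i = Σ (Play n σ) λ π → end n σ π ≡ i

  -- Position i is one that a winning strategy reaches, not necessarily the one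
  -- at which it starts: this makes the continuation after a move a winning
  -- strategy again without shifting the approximations.
  record Winning (i : I) : Set ℓ where
    field
      start    : I
      strategy : ∀ n → Strategy start n
      coherent : ∀ n → proj₁ (strategy (suc n)) ≡ strategy n
      length   : ℕ
      reaches  : Reaches start length (strategy length) i

  -- The reply is stored in the approximation one round longer than the play that reached `i`;
  -- coherence lets that play be read as a play against it.
  respond : ∀ {i} → Winning i → (a : A i) → Σ (B a) λ b → Winning (next b)
  respond w = λ a → go (strategy (suc length)) refl (coherent length) reaches a
    where
    open Winning w

    -- The approximation and its truncation become variables, so that the equations in `coherent`
    -- and `reaches` can be matched with `refl`.
    go : (τ : Strategy start (suc length)) → strategy (suc length) ≡ τ →
         ∀ {σ} → proj₁ τ ≡ σ → ∀ {i} → Reaches start length σ i →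
         (a : A i) → Σ (B a) λ b → Winning (next b)
    go (_ , r) e refl (π , refl) a = r π a , record
      { start    = start
      ; strategy = strategy
      ; coherent = coherent
      ; length   = suc length
      ; reaches  = subst (λ τ → Reaches start (suc length) τ (next (r π a)))
                     (sym e) ((π , a) , refl)
      }

  -- The invariant `P` holds at the end of every play and supplies the next reply, but it is
  -- projected away from the strategy. Its level is therefore free.
  winning : ∀ {p} (P : I → Set p) →
            (∀ {i} → P i → (a : A i) → Σ (B a) λ b → P (next b)) →
            ∀ {i} → P i → Winning i
  winning P f {i} p = record
    { start    = i
    ; strategy = λ n → proj₁ (σ n)
    ; coherent = λ _ → refl
    ; length   = 0
    ; reaches  = tt , refl
    }
    where
    σ : ∀ n → Σ (Strategy i n) λ σ → ∀ π → P (end i n σ π)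
    σ zero    = tt , λ _ → p
    σ (suc n) = let σₙ , inv = σ n in
      (σₙ , λ π a → proj₁ (f (inv π) a)) , λ (π , a) → proj₂ (f (inv π) a)

module _ {ℓ} (C : SmallCategory ℓ) (O : Setoid (lsuc ℓ) ℓ) where

  private
    module C = SmallCategory C
    module O = Setoid O

  -- Bisimulations of transition systems labelled by contexts and observations.

  record TransitionSystem a t : Set (lsuc (ℓ ⊔ a ⊔ t)) where
    field
      State : ∣ C ∣ → Set a
      Step  : ∀ {k l j} → State k → C [ k , l ] → Carrier O → State j → Set t

  module _ {a t b u} (𝒜 : TransitionSystem a t) (ℬ : TransitionSystem b u) where

    private
      module 𝒜 = TransitionSystem 𝒜
      module ℬ = TransitionSystem ℬ

    IsSimulation : ∀ {r} → (∀ k → REL (𝒜.State k) (ℬ.State k) r) → Set _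
    IsSimulation R =
      ∀ {k x y} → R k x y → ∀ {l j} {c : C [ k , l ]} {o} {x′ : 𝒜.State j} →
      𝒜.Step x c o x′ → ∃ λ y′ → ℬ.Step y c o y′ × R j x′ y′

  record Bisimulation {a t b u} (𝒜 : TransitionSystem a t)
           (ℬ : TransitionSystem b u) r
         : Set (a ⊔ t ⊔ b ⊔ u ⊔ lsuc (ℓ ⊔ r)) where
    field
      Related : ∀ k → REL (TransitionSystem.State 𝒜 k) (TransitionSystem.State ℬ k) r
      forth   : IsSimulation 𝒜 ℬ Related
      back    : IsSimulation ℬ 𝒜 (λ k → flip (Related k))

  open Bisimulation

  converse : ∀ {a t b u r} {𝒜 : TransitionSystem a t} {ℬ : TransitionSystem b u} →
             Bisimulation 𝒜 ℬ r → Bisimulation ℬ 𝒜 r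
  converse R = record
    { Related = λ k → flip (Related R k) ; forth = back R ; back = forth R }

  infixl 7 _⨾ᵇ_

  _⨾ᵇ_ : ∀ {a t b u d v r s} {𝒜 : TransitionSystem a t}
         {ℬ : TransitionSystem b u} {𝒟 : TransitionSystem d v} →
         Bisimulation 𝒜 ℬ r → Bisimulation ℬ 𝒟 s →
         Bisimulation 𝒜 𝒟 (b ⊔ r ⊔ s)
  R ⨾ᵇ S = record
    { Related = λ k x z → ∃ λ y → Related R k x y × Related S k y z
    ; forth   = λ (y , p , q) s →
        let y′ , s′ , p′ = forth R p s
            z′ , s″ , q′ = forth S q s′
        in z′ , s″ , y′ , p′ , q′
    ; back    = λ (y , p , q) s →
        let y′ , s′ , q′ = back S q s
            x′ , s″ , p′ = back R p s′
        in x′ , s″ , y′ , p′ , q′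
    }

  -- Small graphs in which the edges out of a node are indexed by a subset of ℕ.
  record System : Set (lsuc ℓ) where
    field
      Node     : Set ℓ
      sort     : Node → ∣ C ∣
      edge     : Node → Pred ℕ ℓ
      edge-irr : ∀ {s n} → Irrelevant (edge s n)
      arrow    : ∀ {s n} → edge s n → ArrowFrom C (sort s)
      label    : ∀ {s n} → edge s n → Carrier O
      next     : ∀ {s n} → edge s n → Node

    -- (s , d) stands for the behaviour of s after inserting it into d.
    Point : ∣ C ∣ → Set ℓ
    Point k = Σ Node λ s → C [ sort s , k ]

    target : ∀ {s n} → edge s n → Σ ∣ C ∣ Point
    target e = sort (next e) , next e , C.id _

    -- As in the operations of H, the pending context `d` keeps the edges whose arrow factors
    -- through `d`, and the remaining factor becomes the label. The observation is read off the
    -- edge, since quantifying over `O` would leave `Set ℓ`.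
    Challenge : ∀ {k} → Point k → Set ℓ
    Challenge {k} (s , d) = ∃ λ n → Σ (edge s n) λ e →
      ∃ λ l → Σ (C [ k , l ]) λ c → arrow e ≡ (l , d C.⨾ c)

    pointed : TransitionSystem ℓ ℓ
    pointed = record
      { State = Point
      ; Step  = λ {_} {l} {j} (s , d) c o x → ∃ λ n → Σ (edge s n) λ e →
          arrow e ≡ (l , d C.⨾ c) × label e O.≈ o × target e ≡ (j , x)
      }

    open TransitionSystem pointed public using (Step)

  -- Equality of behaviours as a game.

  private module BisimulationGame (S T : System) where

    private
      module S = System S
      module T = System T

    Position : Set ℓ
    Position = Σ ∣ C ∣ λ k → S.Point k × T.Point k

    Challenges : Position → Set ℓ
    Challenges (_ , x , y) = S.Challenge x ⊎ T.Challenge y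

    Replies : ∀ {i} → Challenges i → Set ℓ
    Replies {_ , _ , y} (inj₁ (_ , e , _ , c , _)) =
      ∃ λ y′ → T.Step {j = S.sort (S.next e)} y c (S.label e) y′
    Replies {_ , x , _} (inj₂ (_ , e , _ , c , _)) =
      ∃ λ x′ → S.Step {j = T.sort (T.next e)} x c (T.label e) x′

    after : ∀ {i} {a : Challenges i} → Replies a → Position
    after {a = inj₁ (_ , e , _)} (y , _) = _ , proj₂ (S.target e) , y
    after {a = inj₂ (_ , e , _)} (x , _) = _ , x , proj₂ (T.target e)

    open Game Challenges (λ {i} → Replies {i}) (λ {i} {a} → after {i} {a}) public

  Behaviour : ∣ C ∣ → Set (lsuc ℓ)
  Behaviour k = Σ System λ S → System.Point S k

  behaviours : TransitionSystem (lsuc ℓ) (lsuc ℓ)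
  behaviours = record
    { State = Behaviour
    ; Step  = λ (S , x) c o y →
        ∃ λ x′ → System.Step S x c o x′ × y ≡ (S , x′)
    }

  open TransitionSystem behaviours using (Step)

  _≈_ : ∀ {k} → Rel (Behaviour k) ℓ
  (S , x) ≈ (T , y) = BisimulationGame.Winning S T (_ , x , y)

  Step-≈ₒ : ∀ (S : System) {k l j} {x : System.Point S k} {c : C [ k , l ]}
            {o o′} {x′ : System.Point S j} → o O.≈ o′ →
            System.Step S x c o x′ → System.Step S x c o′ x′
  Step-≈ₒ _ p (n , e , q , r , s) = n , e , q , O.trans r p , s

  -- A winning strategy answers with the label of the challenged edge; `Step-≈ₒ` moves the answer to
  -- the equal observation of the given step.
  bisimilarity : Bisimulation behaviours behaviours ℓ
  bisimilarity = record
    { Related = λ _ → _≈_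
    ; forth   = λ { {x = S , x} {T , y} w (_ , (n , e , p , q , refl) , refl) →
        let (y′ , s) , w′ = BisimulationGame.respond S T w (inj₁ (n , e , _ , _ , p))
        in (T , y′) , (y′ , Step-≈ₒ T q s , refl) , w′ }
    ; back    = λ { {x = T , y} {S , x} w (_ , (n , e , p , q , refl) , refl) →
        let (x′ , s) , w′ = BisimulationGame.respond S T w (inj₂ (n , e , _ , _ , p))
        in (S , x′) , (x′ , Step-≈ₒ S q s , refl) , w′ }
    }

  -- Coinduction: the bisimulation is the invariant that guides the strategy. Its level is free, so
  -- composites through large state spaces are allowed.
  bisimulation⊆≈ : ∀ {r} (R : Bisimulation behaviours behaviours r) →
                   ∀ {k x y} → Related R k x y → x ≈ y
  bisimulation⊆≈ R {x = S , _} {T , _} = BisimulationGame.winning S T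
    (λ (k , x , y) → Related R k (S , x) (T , y))
    λ { r (inj₁ (n , e , _ , _ , p)) →
        reply₁ (forth R r (_ , (n , e , p , O.refl , refl) , refl))
      ; r (inj₂ (n , e , _ , _ , p)) →
        reply₂ (back R r (_ , (n , e , p , O.refl , refl) , refl)) }
    where
    -- Steps of a behaviour stay in its graph, so the answer is a point of the fixed graph `T`.
    reply₁ : ∀ {k l j} {y : System.Point T k} {c : C [ k , l ]} {o} {x′ : Behaviour j} →
      (∃ λ y′ → Step (T , y) c o y′ × Related R j x′ y′) →
      Σ (∃ λ y′ → System.Step T y c o y′) λ (y′ , _) → Related R j x′ (T , y′)
    reply₁ (_ , (y′ , s , refl) , r) = (y′ , s) , r

    reply₂ : ∀ {k l j} {x : System.Point S k} {c : C [ k , l ]} {o} {y′ : Behaviour j} →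
      (∃ λ x′ → Step (S , x) c o x′ × Related R j x′ y′) →
      Σ (∃ λ x′ → System.Step S x c o x′) λ (x′ , _) → Related R j (S , x′) y′
    reply₂ (_ , (x′ , s , refl) , r) = (x′ , s) , r

  equality : Bisimulation behaviours behaviours (lsuc ℓ)
  equality = record
    { Related = λ _ → _≡_
    ; forth   = λ { refl s → _ , s , refl }
    ; back    = λ { refl s → _ , s , refl }
    }

  ≈-setoid : ∣ C ∣ → Setoid (lsuc ℓ) ℓ
  ≈-setoid k = record
    { Carrier       = Behaviour k
    ; _≈_           = _≈_
    ; isEquivalence = record
      { refl  = bisimulation⊆≈ equality refl
      ; sym   = bisimulation⊆≈ (converse bisimilarity)
      ; trans = λ p q → bisimulation⊆≈ (bisimilarity ⨾ᵇ bisimilarity) (_ , p , q)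
      }
    }

  private
    module ≈ {k} = Setoid (≈-setoid k)

  -- The algebra of behaviours.

  infixl 8 _·_

  _·_ : ∀ {k l} → Behaviour k → C [ k , l ] → Behaviour l
  (S , s , d) · c = S , s , d C.⨾ c

  step-· : ∀ {k l m j} (x : Behaviour k) (d : C [ k , l ]) {c : C [ l , m ]} {o}
           {y : Behaviour j} → Step (x · d) c o y ⇔ Step x (d C.⨾ c) o y
  step-· (_ , _ , b) d {c} = mk⇔
    (λ (y , (n , e , p , q) , r) →
      y , (n , e , trans p (cong (_ ,_) (C.⨾-assoc b d c)) , q) , r)
    (λ (y , (n , e , p , q) , r) →
      y , (n , e , trans p (cong (_ ,_) (sym (C.⨾-assoc b d c))) , q) , r)

  -- One application of a context suffices: a step of `x · d` is a step of `x` under a longer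
  -- context with the same target, so the targets fall under `base`.
  data Context : ∀ k → Rel (Behaviour k) (lsuc ℓ) where
    base : ∀ {k x y} → x ≈ y → Context k x y
    _·ᶜ_ : ∀ {k l x y} → x ≈ y → (d : C [ k , l ]) → Context l (x · d) (y · d)

  ·-closure : Bisimulation behaviours behaviours (lsuc ℓ)
  ·-closure = record
    { Related = Context
    ; forth   = λ
      { (base p) s → let y , t , q = forth bisimilarity p s in y , t , base q
      ; (_·ᶜ_ {x = x} {y} p d) s →
          let z , t , q = forth bisimilarity p (Equivalence.to (step-· x d) s)
          in z , Equivalence.from (step-· y d) t , base q }
    ; back    = λ
      { (base p) s → let y , t , q = back bisimilarity p s in y , t , base q
      ; (_·ᶜ_ {x = x} {y} p d) s →
          let z , t , q = back bisimilarity p (Equivalence.to (step-· y d) s)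
          in z , Equivalence.from (step-· x d) t , base q }
    }

  behaviourAlgebra : Algebra C
  behaviourAlgebra = record
    { X     = ≈-setoid
    ; op    = λ d → record
      { to = _· d ; cong = λ p → bisimulation⊆≈ ·-closure (p ·ᶜ d) }
    ; op-id = λ (S , s , d) →
        ≈.reflexive (cong (λ d → S , s , d) (C.⨾-idʳ d))
    ; op-⨾  = λ d e (S , s , c) →
        ≈.reflexive (cong (λ d → S , s , d) (sym (C.⨾-assoc c d e)))
    }

  -- The coalgebra of behaviours.

  module _ (C-countable : CountablyManyArrows C) where

    private
      𝐇 : Endofunctor (Alg C)
      𝐇 = H C C-countable O

    module _ (𝔸 : Coalgebra 𝐇) where

      private
        𝕏 = Coalgebra.carrier 𝔸
        module 𝕏 = Algebra 𝕏
        module α = Homomorphism (Coalgebra.structure 𝔸)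

      transitions : TransitionSystem (lsuc ℓ) ℓ
      transitions = record
        { State = λ k → Carrier (𝕏.X k)
        ; Step  = λ {k} {l} {j} p c o q →
            _∈_ {A = Triples C C-countable O 𝕏 k}
              ((l , c) , o , (j , q)) (α.map k ⟨$⟩ p)
        }

    private
      T : ∣ C ∣ → Setoid (lsuc ℓ) ℓ
      T = Triples C C-countable O behaviourAlgebra

    edges : (S : System) (s : System.Node S) → CountableSubset (T (System.sort S s))
    edges S s = record
      { dom     = S.edge s
      ; dom-irr = S.edge-irr
      ; enum    = λ e → S.arrow e , S.label e , S.sort (S.next e) , S , S.next e , C.id _
      }
      where module S = System S

    private
      out-countable : ∀ {k} ((S , s , d) : Behaviour k) →
        IsCountable {A = T k} (d⟦_⟧ C C-countable O behaviourAlgebra d (edges S s))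
      out-countable (S , s , d) =
        d⟦⟧-countable C C-countable O behaviourAlgebra d (edges S s)

    -- Naturality dictates this choice: a pending context acts on the edges of the node as in H.
    -- Naturality of the structure map is then functoriality of that action.
    out : ∀ {k} → Behaviour k → CountableSubset (T k)
    out x = proj₁ (out-countable x)

    -- Membership allows an equal target, whereas `Step` fixes it on the nose; hence the second
    -- behaviour `y′`.
    ∈-out : ∀ {k l j} (x : Behaviour k) {c : C [ k , l ]} {o} {y : Behaviour j} →
            (∃ λ (y′ : Behaviour j) → Step x c o y′ × y′ ≈ y) ⇔
            _∈_ {A = T k} ((l , c) , o , (j , y)) (out x)
    ∈-out {k} {l} {j} x@(S , s , d) {c} {o} {y} = mk⇔
      (λ { (_ , (_ , (n , e , p , q , refl) , refl) , r) →
        Equivalence.to (proj₂ (out-countable x) _)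
          (_ , (n , e , p , q , refl , r) , refl) })
      (λ m → step (Equivalence.from (proj₂ (out-countable x) _) m))
      where
      step : d⟦_⟧ C C-countable O behaviourAlgebra d (edges S s)
               ((l , c) , o , (j , y)) →
             ∃ λ (y′ : Behaviour j) → Step x c o y′ × y′ ≈ y
      step (_ , (n , e , p , q , refl , r) , refl) =
        _ , (_ , (n , e , p , q , refl) , refl) , r

    out-mono : ∀ {k} {x y : Behaviour k} → x ≈ y →
               _⊆_ {A = T k} (out x) (out y)
    out-mono {k} {x} {y} p = ⊆-intro {A = T k} (out x) (out y) λ m →
      let x′ , s , q = Equivalence.from (∈-out x) m
          y′ , t , r = forth bisimilarity p s
      in Equivalence.to (∈-out y) (y′ , t , ≈.trans (≈.sym r) q)

    behaviourCoalgebra : Coalgebra 𝐇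
    behaviourCoalgebra = ⟨ behaviourAlgebra , record
      { map     = λ k → record
        { to   = out
        ; cong = λ p → out-mono p , out-mono (≈.sym p)
        }
      ; natural = λ { c (S , s , d) →
          Algebra.op-⨾ (H₀ C C-countable O behaviourAlgebra) d c (edges S s) }
      } ⟩

    -- Reconciles two readings of a behaviour: the steps of its graph and the elements of `out`.
    -- Their targets differ by `_≈_`, which the relation absorbs.
    ≈-out : Bisimulation behaviours (transitions behaviourCoalgebra) ℓ
    ≈-out = record
      { Related = λ _ → _≈_
      ; forth   = λ {_} {x} {y} p s →
          let y′ , t , q = forth bisimilarity p s
          in y′ , Equivalence.to (∈-out y) (y′ , t , ≈.refl) , q
      ; back    = λ {_} {y} {x} p m →
          let y′ , s , q = Equivalence.from (∈-out y) m
              x′ , t , r = back bisimilarity p s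
          in x′ , t , ≈.trans r q
      }

    -- Coalgebra morphisms as bisimulations.

    module _ {𝔸 𝔹 : Coalgebra 𝐇} (f : CoalgebraMorphism 𝐇 𝔸 𝔹) where

      private
        module 𝕏 = Algebra (Coalgebra.carrier 𝔸)
        module 𝕐 = Algebra (Coalgebra.carrier 𝔹)
        module α = Homomorphism (Coalgebra.structure 𝔸)
        module β = Homomorphism (Coalgebra.structure 𝔹)
        module f = Homomorphism (CoalgebraMorphism.arrow f)
        module 𝕐ₛ {k} = Setoid (𝕐.X k)

        TY : ∣ C ∣ → Setoid (lsuc ℓ) ℓ
        TY = Triples C C-countable O (Coalgebra.carrier 𝔹)

        image-α : ∀ {k} → Carrier (𝕏.X k) → CountableSubset (TY k)
        image-α {k} p = Homomorphism.map
          (H₁ C C-countable O (CoalgebraMorphism.arrow f)) k ⟨$⟩ (α.map k ⟨$⟩ p)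

      -- The commuting square equates the image of the successors of `p` with the successors of its
      -- image; the two inclusions give `forth` and `back`.
      graph : Bisimulation (transitions 𝔸) (transitions 𝔹) ℓ
      graph = record
        { Related = λ k p y → f.map k ⟨$⟩ p 𝕐ₛ.≈ y
        ; forth   = λ {k} {p} {y} e (n , d , q , r , s) →
            _ , ⊆-elim {A = TY k} (β.map k ⟨$⟩ (f.map k ⟨$⟩ p)) (β.map k ⟨$⟩ y)
                  (proj₁ (Func.cong (β.map k) e))
                (⊆-elim {A = TY k} (image-α p) (β.map k ⟨$⟩ (f.map k ⟨$⟩ p))
                  (proj₁ (CoalgebraMorphism.commutes f k p))
                (n , d , q , r , f.∫map-cong s))
              , 𝕐ₛ.refl
        ; back    = λ {k} {y} {p} e m → preimage
            (⊆-elim {A = TY k} (β.map k ⟨$⟩ (f.map k ⟨$⟩ p)) (image-α p)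
              (proj₂ (CoalgebraMorphism.commutes f k p))
            (⊆-elim {A = TY k} (β.map k ⟨$⟩ y) (β.map k ⟨$⟩ (f.map k ⟨$⟩ p))
              (proj₂ (Func.cong (β.map k) e)) m))
        }
        where
        preimage : ∀ {k l j} {p : Carrier (𝕏.X k)} {c : C [ k , l ]} {o}
                   {y : Carrier (𝕐.X j)} →
          _∈_ {A = TY k} ((l , c) , o , (j , y)) (image-α p) →
          ∃ λ q → TransitionSystem.Step (transitions 𝔸) p c o q × f.map j ⟨$⟩ q 𝕐ₛ.≈ y
        preimage (n , d , q , r , refl , s) = _ , (n , d , q , r , refl , 𝕏ₛ.refl) , s
          where module 𝕏ₛ {k} = Setoid (𝕏.X k)

    -- Unravelling of a coalgebra, and finality.

    module _ (𝔸 : Coalgebra 𝐇) where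

      private
        𝕏 = Coalgebra.carrier 𝔸
        module 𝕏 = Algebra 𝕏
        module 𝕏ₛ {k} = Setoid (𝕏.X k)
        module α = Homomorphism (Coalgebra.structure 𝔸)

        TX : ∣ C ∣ → Setoid (lsuc ℓ) ℓ
        TX = Triples C C-countable O 𝕏

        successors : ((k , _) : Carrier 𝕏.∫) → CountableSubset (TX k)
        successors (k , p) = α.map k ⟨$⟩ p

      -- Induction-recursion keeps paths in Set ℓ although states are not.
      data Path (p : Carrier 𝕏.∫) : Set ℓ
      endpoint : ∀ {p} → Path p → Carrier 𝕏.∫

      data Path p where
        []  : Path p
        _▻_ : (w : Path p) → ∀ {n} → dom (successors (endpoint w)) n → Path p

      endpoint {p} []  = p
      endpoint (w ▻ d) = proj₂ (proj₂ (enum (successors (endpoint w)) d))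

      unravelling : Carrier 𝕏.∫ → System
      unravelling p = record
        { Node     = Path p
        ; sort     = λ w → proj₁ (endpoint w)
        ; edge     = λ w → dom (successors (endpoint w))
        ; edge-irr = λ {w} → dom-irr (successors (endpoint w))
        ; arrow    = λ {w} d → proj₁ (enum (successors (endpoint w)) d)
        ; label    = λ {w} d → proj₁ (proj₂ (enum (successors (endpoint w)) d))
        ; next     = λ {w} → w ▻_
        }

      -- The state denoted by a point is the endpoint of its path with the pending context applied.
      -- The root `p` is arbitrary, so unravellings from different roots can meet in one state.
      data _▹_ : ∀ {k} → Behaviour k → Carrier (𝕏.X k) → Set (lsuc ℓ) where
        along : ∀ {p k} (w : Path p) (d : C [ proj₁ (endpoint w) , k ]) {q} →
                (𝕏.op d ⟨$⟩ proj₂ (endpoint w)) 𝕏ₛ.≈ q →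
                (unravelling p , w , d) ▹ q

      private
        op-H : ∀ {k l} → C [ k , l ] → CountableSubset (TX k) → CountableSubset (TX l)
        op-H d A = Algebra.op (H₀ C C-countable O 𝕏) d ⟨$⟩ A

        -- This is naturality of the structure map at `d`, followed by its congruence along `e`.
        ∈-successors : ∀ {k l} (d : C [ k , l ]) {p q} → (𝕏.op d ⟨$⟩ p) 𝕏ₛ.≈ q → ∀ {t} →
          d⟦_⟧ C C-countable O 𝕏 d (successors (k , p)) t ⇔
          _∈_ {A = TX l} t (successors (l , q))
        ∈-successors {k} {l} d {p} {q} e {t} = mk⇔
          (λ m → ⊆-elim {A = TX l} Sₚ S (proj₁ S-≈)
            (⊆-elim {A = TX l} (op-H d (successors (k , p))) Sₚ (proj₂ (α.natural d p))
              (Equivalence.to (spec t) m)))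
          (λ m → Equivalence.from (spec t)
            (⊆-elim {A = TX l} Sₚ (op-H d (successors (k , p))) (proj₁ (α.natural d p))
              (⊆-elim {A = TX l} S Sₚ (proj₂ S-≈) m)))
          where
          S Sₚ : CountableSubset (TX l)
          S  = successors (l , q)
          Sₚ = successors (l , (𝕏.op d ⟨$⟩ p))
          S-≈ = Func.cong (α.map l) e
          spec = proj₂ (d⟦⟧-countable C C-countable O 𝕏 d (successors (k , p)))

      unfolds : Bisimulation behaviours (transitions 𝔸) (lsuc ℓ)
      unfolds = record
        { Related = λ _ → _▹_
        ; forth   = λ { (along w d e) (_ , (n , b , p , q , refl) , refl) →
            _ , Equivalence.to (∈-successors d e)
                  (_ , (n , b , p , q , Setoid.refl 𝕏.∫) , refl)
              -- Traversing an edge leaves the identity context pending, which `op-id` removes.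
              , along (w ▻ b) (C.id _) (𝕏.op-id _) }
        ; back    = λ { (along w d e) m → step w d (Equivalence.from (∈-successors d e) m) }
        }
        where
        step : ∀ {p k l j} (w : Path p) (d : C [ proj₁ (endpoint w) , k ])
               {c : C [ k , l ]} {o} {y : Carrier (𝕏.X j)} →
               d⟦_⟧ C C-countable O 𝕏 d (successors (endpoint w)) ((l , c) , o , (j , y)) →
               ∃ λ (x : Behaviour j) → Step (unravelling p , w , d) c o x × x ▹ y
        step w d (_ , (n , b , p , q , refl , r) , refl) =
          _ , (_ , (n , b , p , q , refl) , refl) ,
          along (w ▻ b) (C.id _) (𝕏ₛ.trans (𝕏.op-id _) r)

      -- The common state is the midpoint of a composite bisimulation.
      ▹-≈ : ∀ {k} {x y : Behaviour k} {p} → x ▹ p → y ▹ p → x ≈ y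
      ▹-≈ p q = bisimulation⊆≈ (unfolds ⨾ᵇ converse unfolds) (_ , p , q)

      behaviour : ∀ {k} → Carrier (𝕏.X k) → Behaviour k
      behaviour {k} p = unravelling (k , p) , [] , C.id k

      behaviour-▹ : ∀ {k} {p q : Carrier (𝕏.X k)} → p 𝕏ₛ.≈ q → behaviour p ▹ q
      behaviour-▹ e = along [] (C.id _) (𝕏ₛ.trans (𝕏.op-id _) e)

      unfold : CoalgebraMorphism 𝐇 𝔸 behaviourCoalgebra
      unfold = record
        { arrow    = h
        -- Each inclusion carries a step across `unfolds`; `▹-≈` then identifies the targets.
        ; commutes = λ k p →
            (λ {n} d →
              let x , s , r = back unfolds (behaviour-▹ 𝕏ₛ.refl)
                                (n , d , refl , O.refl , Setoid.refl 𝕏.∫)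
              in Equivalence.to (∈-out (behaviour p)) (x , s , ▹-≈ r (behaviour-▹ 𝕏ₛ.refl)))
          , ⊆-intro {A = T k} (out (behaviour p)) (image-h p) λ m →
              let x , s , x≈y = Equivalence.from (∈-out (behaviour p)) m
                  q , q∈ , x▹q = forth unfolds (behaviour-▹ 𝕏ₛ.refl) s
              in ∈-image q∈ (≈.trans (▹-≈ (behaviour-▹ 𝕏ₛ.refl) x▹q) x≈y)
        }
        where
        h : Homomorphism C 𝕏 behaviourAlgebra
        h = record
          { map     = λ k → record
            { to   = behaviour
            ; cong = λ e → ▹-≈ (behaviour-▹ e) (behaviour-▹ 𝕏ₛ.refl)
            }
          -- Both sides unfold to `c` applied to `p`; on the right the pending context is the
          -- identity followed by `c`.
          ; natural = λ c p → ▹-≈ (behaviour-▹ 𝕏ₛ.refl)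
              (along [] (C.id _ C.⨾ c)
                (𝕏ₛ.trans (𝕏.op-⨾ _ c p) (Func.cong (𝕏.op c) (𝕏.op-id p))))
          }

        image-h : ∀ {k} → Carrier (𝕏.X k) → CountableSubset (T k)
        image-h {k} p = Homomorphism.map (H₁ C C-countable O h) k ⟨$⟩ successors (k , p)

        ∈-image : ∀ {k l j} {p : Carrier (𝕏.X k)} {c : C [ k , l ]} {o}
                  {q : Carrier (𝕏.X j)} {y} →
          TransitionSystem.Step (transitions 𝔸) p c o q → behaviour q ≈ y →
          _∈_ {A = T k} ((l , c) , o , (j , y)) (image-h p)
        ∈-image (n , d , a , b , refl , e) r = n , d , a , b , refl ,
          ≈.trans (▹-≈ (behaviour-▹ e) (behaviour-▹ 𝕏ₛ.refl)) r

      -- The image of `p` under `f` is bisimilar to `p` by the graph of `f`, and `p` to its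
      -- behaviour by `unfolds`.
      unfold-unique : (f : CoalgebraMorphism 𝐇 𝔸 behaviourCoalgebra) → ∀ k p →
        (Homomorphism.map (CoalgebraMorphism.arrow f) k ⟨$⟩ p) ≈ behaviour p
      unfold-unique f k p = bisimulation⊆≈
        (≈-out ⨾ᵇ converse (graph f) ⨾ᵇ converse unfolds)
        (p , (_ , ≈.refl , ≈.refl) , behaviour-▹ 𝕏ₛ.refl)

    finalCoalgebra : FinalObject (Coalg 𝐇)
    finalCoalgebra = record
      { ⊤        = behaviourCoalgebra
      ; !        = unfold
      ; !-unique = λ {𝔸} → unfold-unique 𝔸
      }

    -- Bisimilar states in an arbitrary final coalgebra.

    module _ (Ω : FinalObject (Coalg 𝐇)) (𝔸 : Coalgebra 𝐇) where

      private
        module Ω = FinalObject Ω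
        module 𝕏 = Algebra (Coalgebra.carrier 𝔸)
        module 𝕐 = Algebra (Coalgebra.carrier Ω.⊤)
        module 𝕐ₛ {k} = Setoid (𝕐.X k)
        module ! = Homomorphism (CoalgebraMorphism.arrow (Ω.! 𝔸))

      -- By uniqueness the map into `Ω` factors through `unfold`, which already identifies related
      -- states.
      bisimilar⇒same-image : ∀ {r} (R : Bisimulation (transitions 𝔸) (transitions 𝔸) r) →
        ∀ {k p q} → Related R k p q → (!.map k ⟨$⟩ p) 𝕐ₛ.≈ (!.map k ⟨$⟩ q)
      bisimilar⇒same-image R {k} {p} {q} r = 𝕐ₛ.trans (𝕐ₛ.sym (factors p))
        (𝕐ₛ.trans (Func.cong (g.map k) (bisimulation⊆≈
          (unfolds 𝔸 ⨾ᵇ R ⨾ᵇ converse (unfolds 𝔸))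
          (q , (p , behaviour-▹ 𝔸 𝕏ₛ.refl , r) , behaviour-▹ 𝔸 𝕏ₛ.refl)))
        (factors q))
        where
        module 𝕏ₛ {k} = Setoid (𝕏.X k)
        module g = Homomorphism (CoalgebraMorphism.arrow (Ω.! behaviourCoalgebra))
        factors : ∀ p → (g.map k ⟨$⟩ behaviour 𝔸 p) 𝕐ₛ.≈ (!.map k ⟨$⟩ p)
        factors p = Ω.!-unique (Category._⨾_ (Coalg 𝐇) (unfold 𝔸) (Ω.! behaviourCoalgebra)) k p

-- Saturated bisimilarity as a kernel.

module _ {ℓ} (ℐ : ContextInteractiveSystem ℓ) where
  open ContextInteractiveSystem ℐ

  module _ (C-countable : CountablyManyArrows C) (tr-countable : CountableDegree ℐ) where

    private
      module C = SmallCategory C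
      module O = Setoid O
      module ∫ = Setoid ∫
      module Xₛ {k} = Setoid (X k)

      𝔸 : Coalgebra (H C C-countable O)
      𝔸 = saturatedCoalgebra ℐ C-countable tr-countable

      𝒜 : TransitionSystem C O _ ℓ
      𝒜 = transitions C O C-countable 𝔸

      module 𝒜 = TransitionSystem 𝒜

    step-⇔ : ∀ {i l j} (p : Carrier (X i)) {c : C [ i , l ]} {o} {q : Carrier (X j)} →
             tr (l , (op c ⟨$⟩ p)) o (j , q) ⇔ 𝒜.Step p c o q
    step-⇔ p = proj₂ (saturatedTransitions-countable ℐ C-countable tr-countable p) _

    -- A saturated step under `c` is a transition after inserting into `c`: `closed` relates the two
    -- instances and `simulates` matches the transition.
    saturated⇒bisimulation : {R : ∀ i → Rel (Carrier (X i)) ℓ} →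
      IsSaturatedBisimulation ℐ R →
      Bisimulation C O 𝒜 𝒜 ℓ
    saturated⇒bisimulation {R} R-sat = record
      { Related = R
      ; forth   = forth′
      ; back    = λ r s →
          let y , t , r′ = forth′ (symmetric _ r) s in y , t , symmetric _ r′
      }
      where
      open IsSaturatedBisimulation R-sat
      forth′ : IsSimulation C O 𝒜 𝒜 R
      forth′ {_} {p} {q} r {c = c} s =
        let y , t , r′ = simulates (closed c r) (Equivalence.from (step-⇔ p) s)
        in y , Equivalence.to (step-⇔ q) t , r′

    -- Closure under contexts is naturality of `f`; matching of transitions comes from composing the
    -- graph of `f` with its converse.
    kernel-saturated : ∀ {𝔹} (f : CoalgebraMorphism (H C C-countable O) 𝔸 𝔹) →
      let open Homomorphism (CoalgebraMorphism.arrow f) in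
      IsSaturatedBisimulation ℐ λ i p q →
        Setoid._≈_ (Algebra.X (Coalgebra.carrier 𝔹) i) (map i ⟨$⟩ p) (map i ⟨$⟩ q)
    kernel-saturated {𝔹} f = record
      { respects  = λ {i} e e′ r → 𝕐ₛ.trans (𝕐ₛ.sym (Func.cong (map i) e))
                      (𝕐ₛ.trans r (Func.cong (map i) e′))
      ; symmetric = λ _ → 𝕐ₛ.sym
      ; closed    = λ c {p} {q} r → 𝕐ₛ.trans (natural c p)
                      (𝕐ₛ.trans (Func.cong (Algebra.op (Coalgebra.carrier 𝔹) c) r)
                        (𝕐ₛ.sym (natural c q)))
      ; simulates = λ {i} {p} {q} r {o} {k} {p′} t →
          let q′ , s , y , e , e′ = forth kernel (_ , 𝕐ₛ.refl , 𝕐ₛ.sym r)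
                -- A plain transition of `p` is a saturated step under the identity context.
                (Equivalence.to (step-⇔ p)
                  (tr-resp (refl , Xₛ.sym (op-id p)) O.refl ∫.refl t))
          in q′
           , tr-resp (refl , op-id q) O.refl ∫.refl (Equivalence.from (step-⇔ q) s)
           , 𝕐ₛ.trans e (𝕐ₛ.sym e′)
      }
      where
      open Homomorphism (CoalgebraMorphism.arrow f)
      open Bisimulation
      module 𝕐ₛ {k} = Setoid (Algebra.X (Coalgebra.carrier 𝔹) k)
      kernel : Bisimulation C O 𝒜 𝒜 (lsuc ℓ)
      kernel = _⨾ᵇ_ C O (graph C O C-countable f) (converse C O (graph C O C-countable f))

mainTheorem3 : {ℓ : Level} (ℐ : ContextInteractiveSystem ℓ) →
    let open ContextInteractiveSystem ℐ in
    (C-countable : CountablyManyArrows C) (tr-countable : CountableDegree ℐ) →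
    FinalObject (Coalg (H C C-countable O)) ×
    ((Ω : FinalObject (Coalg (H C C-countable O))) →
      let open FinalObject Ω
          module ⊤ = Algebra (Coalgebra.carrier ⊤)
          open Homomorphism
            (CoalgebraMorphism.arrow (! (saturatedCoalgebra ℐ C-countable tr-countable)))
      in ∀ i (p q : Setoid.Carrier (X i)) →
         _∼ˢ_ ℐ p q ⇔ Setoid._≈_ (⊤.X i) (map i ⟨$⟩ p) (map i ⟨$⟩ q))
mainTheorem3 ℐ C-countable tr-countable =
  finalCoalgebra C O C-countable , λ Ω i p q → mk⇔
    (λ (R , R-sat , r) → bisimilar⇒same-image C O C-countable Ω _
      (saturated⇒bisimulation ℐ C-countable tr-countable R-sat) r)
    (λ e → _ , kernel-saturated ℐ C-countable tr-countable (FinalObject.! Ω _) , e)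
  where open ContextInteractiveSystem ℐ
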